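{- Suppose $G$ is a finite simple connected graph, and let $k,d,k',d'$ be positive integers satisfying \[1\le k-1\le d\le\mathrm{diam}(G)\quad\text{and}\quad 1\le k'-1\le d'\le\mathrm{diam}(G).\] If $d'\le d$ and $k'\ge k$, then \[\alpha^k_d(G)\le\alpha^{k'}_{d'}(G),\quad \chi^k_d(G)\ge\chi^{k'}_{d'}(G),\quad \omega^k_d(G)\ge\omega^{k'}_{d'}(G),\quad \gamma^k_d(G)\le\gamma^{k'}_{d'}(G).\]
   Context: A shortest path in a graph $G$ is a path between some vertices $u,v$ whose length (number of edges) equals the graph distance between $u$ and $v$. A set $S\subseteq V(G)$ is $k,d$-independent in $G$ if every shortest path in $G$ of length at most $d$ contains fewer than $k$ vertices of $S$; $\alpha^k_d(G)$ is the supremum of the sizes of $k,d$-independent sets. $\chi^k_d(G)$ is the least positive integer $c$ such that some coloring $V(G)\to\{1,\dots,c\}$ has all color classes $k,d$-independent. A set $S\subseteq V(G)$ is a $k,d$-clique in $G$ if every $k$-element subset of $S$ is contained in some shortest path of $G$ of length at most $d$ (sets with fewer than $k$ elements are vacuously $k,d$-cliques); $\omega^k_d(G)$ is the supremum of the sizes of $k,d$-cliques in $G$. A set $D\subseteq V(G)$ is $k,d$-dominating in $G$ if for every $v\in V(G)\setminus D$ there is a shortest path $P$ in $G$ of length at most $d$ containing $v$ with $|V(P)\cap D|\ge k-1$; $\gamma^k_d(G)$ is the minimum size of a $k,d$-dominating set in $G$. -}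

module Defs where

open import Data.Fin.Base using (Fin; inject₁)
import Data.Fin.Properties as Fin
open import Data.Fin.Properties using (any?; all?; inject₁-injective; injective⇒≤)
open import Data.Fin.Subset using (Subset; ⊥; ⊤; ⁅_⁆; _∈_; _∉_; _⊆_; _∩_; _∪_; ∣_∣)
open import Data.Fin.Subset.Properties
  using ( ∣p∣≤n; ∣⊥∣≡0; ∣⁅x⁆∣≡1; _∈?_; _⊆?_; anySubset?; p⊆q⇒∣p∣≤∣q∣; x∈p∩q⁻; ∈⊤
        ; nonempty?; Empty-unique; x∈⁅x⁆)
open import Data.Nat.Base using (ℕ; zero; suc; _≤_; _<_; _∸_; z≤n; s≤s)
open import Data.Nat.Induction using (<-rec)
open import Data.Nat.Properties
  using ( _≤?_; _<?_; ≤-trans; ≤-reflexive; ≤∧≢⇒<; ≮⇒≥; ≤⇒≯; n≤1+n; anyUpTo?; allUpTo?)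
  renaming (_≟_ to _≟ℕ_)
open import Data.Product.Base using (∃; ∃-syntax; _×_; _,_; proj₁; proj₂)
open import Data.Vec.Base using (Vec; []; _∷_; foldr′; head; last; lookup; map; tabulate)
open import Data.Vec.Properties using (lookup∘tabulate; tabulate-cong; []=⇒lookup)
open import Data.Vec.Relation.Unary.AllPairs using (allPairs?)
open import Data.Vec.Relation.Unary.Linked using (Linked; linked?)
open import Data.Vec.Relation.Unary.Unique.Propositional using (Unique)
open import Data.Vec.Relation.Unary.Unique.Propositional.Properties using (lookup-injective)
open import Level using (0ℓ)
open import Relation.Binary.Core using (Rel)
open import Relation.Binary.Definitions using (Symmetric; Irreflexive)
  renaming (Decidable to Decidable₂)
open import Relation.Binary.PropositionalEquality
  using (_≡_; refl; sym; trans; cong; subst)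
open import Relation.Nullary using (Dec; yes; no; does; contradiction)
open import Relation.Nullary.Decidable using (map′; _×-dec_; _→-dec_; ¬?; decidable-stable)
open import Relation.Unary using (Pred; Decidable)

private
  variable
    n l : ℕ

IsSupremum : Pred ℕ 0ℓ → Pred ℕ 0ℓ
IsSupremum P s = (∀ m → P m → m ≤ s) × (∀ t → (∀ m → P m → m ≤ t) → s ≤ t)

IsLeast : Pred ℕ 0ℓ → Pred ℕ 0ℓ
IsLeast P m = P m × (∀ l → P l → m ≤ l)

supremum : {P : Pred ℕ 0ℓ} → Decidable P → ∀ b → (∀ m → P m → m ≤ b) → ∃ (IsSupremum P)
supremum P? zero    ub = 0 , ub , λ _ _ → z≤n
supremum {P} P? (suc b) ub with P? (suc b)
... | yes p  = suc b , ub , λ _ ub′ → ub′ (suc b) p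
... | no  ¬p = supremum P? b ub′
  where
  ub′ : ∀ m → P m → m ≤ b
  ub′ m pm with ≤∧≢⇒< (ub m pm) (λ { refl → ¬p pm })
  ... | s≤s m≤b = m≤b

least : {P : Pred ℕ 0ℓ} → Decidable P → ∀ w → P w → ∃ (IsLeast P)
least {P} P? = <-rec (λ w → P w → ∃ (IsLeast P)) step
  where
  step : ∀ w → (∀ {v} → v < w → P v → ∃ (IsLeast P)) → P w → ∃ (IsLeast P)
  step w rec pw with anyUpTo? P? w
  ... | yes (v , v<w , pv) = rec v<w pv
  ... | no  none = w , pw , λ l pl → ≮⇒≥ (λ l<w → none (l , l<w , pl))

record Graph (n : ℕ) : Set₁ where
  field
    Adj    : Rel (Fin n) 0ℓ
    adj?   : Decidable₂ Adj
    symm   : Symmetric Adj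
    irrefl : Irreflexive _≡_ Adj

-- A path of length l is given by its l + 1 successive vertices.

IsPath : Graph n → Vec (Fin n) (suc l) → Set
IsPath G p = Linked (Graph.Adj G) p × Unique p

PathBetween : Graph n → Fin n → Fin n → Pred ℕ 0ℓ
PathBetween {n} G u v l =
  ∃[ p ] IsPath {n} {l} G p × head p ≡ u × last p ≡ v

Connected : Graph n → Set
Connected G = ∀ u v → ∃ (PathBetween G u v)

-- Distance G u v m says that u and v are at distance m; no m satisfies it
-- when u and v lie in different components.
Distance : Graph n → Fin n → Fin n → Pred ℕ 0ℓ
Distance G u v = IsLeast (PathBetween G u v)

IsShortestPath : Graph n → Vec (Fin n) (suc l) → Set
IsShortestPath {l = l} G p = IsPath G p × Distance G (head p) (last p) l

V : Vec (Fin n) l → Subset n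
V p = foldr′ _∪_ ⊥ (map ⁅_⁆ p)

Independent : Graph n → (k d : ℕ) → Subset n → Set
Independent {n} G k d S =
  ∀ l (p : Vec (Fin n) (suc l)) → IsShortestPath G p → l ≤ d → ∣ V p ∩ S ∣ < k

Clique : Graph n → (k d : ℕ) → Subset n → Set
Clique {n} G k d S =
  ∀ (T : Subset n) → T ⊆ S → ∣ T ∣ ≡ k →
  ∃[ l ] ∃[ p ] IsShortestPath {n} {l} G p × l ≤ d × T ⊆ V p

Dominating : Graph n → (k d : ℕ) → Subset n → Set
Dominating {n} G k d D =
  ∀ v → v ∉ D →
  ∃[ l ] ∃[ p ] IsShortestPath {n} {l} G p × l ≤ d × v ∈ V p × k ∸ 1 ≤ ∣ V p ∩ D ∣

colorClass : ∀ {c} → (Fin n → Fin c) → Fin c → Subset n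
colorClass f i = tabulate (λ v → does (f v Fin.≟ i))

IsColoring : Graph n → (k d : ℕ) → ∀ {c} → (Fin n → Fin c) → Set
IsColoring G k d f = ∀ i → Independent G k d (colorClass f i)

SizeOf : Pred (Subset n) 0ℓ → Pred ℕ 0ℓ
SizeOf Q m = ∃[ S ] Q S × ∣ S ∣ ≡ m

ColorableWith : Graph n → (k d : ℕ) → Pred ℕ 0ℓ
ColorableWith {n} G k d c = 1 ≤ c × ∃[ f ] IsColoring G k d {c} f

IsDistanceIn : Graph n → Pred ℕ 0ℓ
IsDistanceIn G m = ∃[ u ] ∃[ v ] Distance G u v m

-- The invariants are obtained below as first components of existence proofs,
-- by exhaustive search over the finitely many paths, subsets and colorings.

anyVec? : ∀ {c} {Q : Pred (Vec (Fin c) l) 0ℓ} → Decidable Q → Dec (∃ Q)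
anyVec? {zero}  Q? = map′ (λ q → [] , q) (λ { ([] , q) → q }) (Q? [])
anyVec? {suc l} Q? =
  map′ (λ { (x , xs , q) → x ∷ xs , q }) (λ { (x ∷ xs , q) → x , xs , q })
       (any? (λ x → anyVec? (λ xs → Q? (x ∷ xs))))

allVec? : ∀ {c} {Q : Pred (Vec (Fin c) l) 0ℓ} → Decidable Q → Dec (∀ p → Q p)
allVec? Q? =
  map′ (λ none p → decidable-stable (Q? p) (λ ¬q → none (p , ¬q)))
       (λ all (p , ¬q) → ¬q (all p))
       (¬? (anyVec? (λ p → ¬? (Q? p))))

allSubset? : {Q : Pred (Subset n) 0ℓ} → Decidable Q → Dec (∀ S → Q S)
allSubset? Q? =
  map′ (λ none S → decidable-stable (Q? S) (λ ¬q → none (S , ¬q)))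
       (λ all (S , ¬q) → ¬q (all S))
       (¬? (anySubset? (λ S → ¬? (Q? S))))

isLeast? : {P : Pred ℕ 0ℓ} → Decidable P → Decidable (IsLeast P)
isLeast? P? m =
  map′ (λ (pm , none) → pm , λ l pl → ≮⇒≥ (λ l<m → none l<m pl))
       (λ (pm , low) → pm , λ {l} l<m pl → ≤⇒≯ (low l pl) l<m)
       (P? m ×-dec allUpTo? (λ l → ¬? (P? l)) m)

module _ (G : Graph n) where

  isPath? : Decidable (IsPath {n} {l} G)
  isPath? p = linked? (Graph.adj? G) p ×-dec allPairs? (λ x y → ¬? (x Fin.≟ y)) p

  pathBetween? : ∀ u v → Decidable (PathBetween G u v)
  pathBetween? u v l =
    anyVec? (λ p → isPath? p ×-dec (head p Fin.≟ u ×-dec last p Fin.≟ v))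

  distance? : ∀ u v → Decidable (Distance G u v)
  distance? u v = isLeast? (pathBetween? u v)

  isShortestPath? : Decidable (IsShortestPath {n} {l} G)
  isShortestPath? {l} p = isPath? p ×-dec distance? (head p) (last p) l

  isDistanceIn? : Decidable (IsDistanceIn G)
  isDistanceIn? m = any? (λ u → any? (λ v → distance? u v m))

  isPath⇒length<n : (p : Vec (Fin n) (suc l)) → IsPath G p → l < n
  isPath⇒length<n p (_ , uniq) = injective⇒≤ (λ {i} {j} → lookup-injective uniq i j)

  someShortestPath? : ∀ d {Q : ∀ l → Pred (Vec (Fin n) (suc l)) 0ℓ} → (∀ l → Decidable (Q l)) →
                      Dec (∃[ l ] ∃[ p ] IsShortestPath {n} {l} G p × l ≤ d × Q l p)
  someShortestPath? d Q? =
    map′ (λ { (l , s≤s l≤d , p , sp , q) → l , p , sp , l≤d , q })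
         (λ { (l , p , sp , l≤d , q) → l , s≤s l≤d , p , sp , q })
         (anyUpTo? (λ l → anyVec? (λ p → isShortestPath? p ×-dec Q? l p)) (suc d))

  independent? : ∀ k d → Decidable (Independent G k d)
  independent? k d S =
    map′ (λ all l p sp l≤d → all (s≤s l≤d) p sp)
         (λ { ind {l} (s≤s l≤d) p sp → ind l p sp l≤d })
         (allUpTo? (λ l → allVec? (λ p → isShortestPath? p →-dec (∣ V p ∩ S ∣ <? k))) (suc d))

  clique? : ∀ k d → Decidable (Clique G k d)
  clique? k d S =
    allSubset? (λ T → (T ⊆? S) →-dec ((∣ T ∣ ≟ℕ k) →-dec someShortestPath? d (λ l p → T ⊆? V p)))

  dominating? : ∀ k d → Decidable (Dominating G k d)
  dominating? k d D =
    all? (λ v → ¬? (v ∈? D) →-dec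
                someShortestPath? d (λ l p → (v ∈? V p) ×-dec (k ∸ 1 ≤? ∣ V p ∩ D ∣)))

  colorableWith? : ∀ k d → Decidable (ColorableWith G k d)
  colorableWith? k d c =
    (1 ≤? c) ×-dec
    map′ (λ (w , col) → lookup w , col)
         (λ (f , col) → tabulate f , λ i → subst (Independent G k d) (sym (same f i)) (col i))
         (anyVec? (λ w → all? (λ i → independent? k d (colorClass (lookup w) i))))
    where
    same : ∀ f i → colorClass (lookup (tabulate f)) i ≡ colorClass f i
    same f i = tabulate-cong (λ v → cong (λ j → does (j Fin.≟ i)) (lookup∘tabulate f v))

sizeOf? : {Q : Pred (Subset n) 0ℓ} → Decidable Q → Decidable (SizeOf Q)
sizeOf? Q? m = anySubset? (λ S → Q? S ×-dec (∣ S ∣ ≟ℕ m))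

sizeOf≤n : {Q : Pred (Subset n) 0ℓ} → ∀ m → SizeOf Q m → m ≤ n
sizeOf≤n m (S , _ , refl) = ∣p∣≤n S

∈-colorClass⁻ : ∀ {c} (f : Fin n → Fin c) i {v} → v ∈ colorClass f i → f v ≡ i
∈-colorClass⁻ f i {v} v∈
  with f v Fin.≟ i | trans (sym (lookup∘tabulate (λ w → does (f w Fin.≟ i)) v)) ([]=⇒lookup v∈)
... | yes eq | _  = eq
... | no  _  | ()

atMostOne : (S : Subset n) → (∀ {x y} → x ∈ S → y ∈ S → x ≡ y) → ∣ S ∣ ≤ 1
atMostOne {n} S uniq with nonempty? S
... | yes (x , x∈S) =
  ≤-trans (p⊆q⇒∣p∣≤∣q∣ (λ y∈S → subst (_∈ ⁅ x ⁆) (uniq x∈S y∈S) (x∈⁅x⁆ x)))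
          (≤-reflexive (∣⁅x⁆∣≡1 x))
... | no empty rewrite Empty-unique empty | ∣⊥∣≡0 n = z≤n

-- When k ≥ 2, giving all vertices different colors is a valid coloring.
colorable : (G : Graph n) → ∀ k d → 1 ≤ k ∸ 1 → ColorableWith G k d (suc n)
colorable G (suc k) d 1≤k = s≤s z≤n , inject₁ , λ i l p _ _ →
  s≤s (≤-trans (atMostOne (V p ∩ colorClass inject₁ i) (λ x∈ y∈ → inject₁-injective
    (trans (color i p x∈) (sym (color i p y∈))))) 1≤k)
  where
  color : ∀ i (p : Vec (Fin _) (suc l)) {x} → x ∈ V p ∩ colorClass inject₁ i → inject₁ x ≡ i
  color i p x∈ = ∈-colorClass⁻ inject₁ i (proj₂ (x∈p∩q⁻ (V p) _ x∈))

diam-exists : (G : Graph n) → ∃ (IsSupremum (IsDistanceIn G))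
diam-exists {n} G = supremum (isDistanceIn? G) n bounded
  where
  bounded : ∀ m → IsDistanceIn G m → m ≤ n
  bounded m (_ , _ , (p , path , _) , _) = ≤-trans (n≤1+n m) (isPath⇒length<n G p path)

α-exists : (G : Graph n) → ∀ k d → ∃ (IsSupremum (SizeOf (Independent G k d)))
α-exists {n} G k d = supremum (sizeOf? (independent? G k d)) n sizeOf≤n

χ-exists : (G : Graph n) → ∀ k d → 1 ≤ k ∸ 1 → ∃ (IsLeast (ColorableWith G k d))
χ-exists {n} G k d 1≤k-1 = least (colorableWith? G k d) (suc n) (colorable G k d 1≤k-1)

ω-exists : (G : Graph n) → ∀ k d → ∃ (IsSupremum (SizeOf (Clique G k d)))
ω-exists {n} G k d = supremum (sizeOf? (clique? G k d)) n sizeOf≤n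

γ-exists : (G : Graph n) → ∀ k d → ∃ (IsLeast (SizeOf (Dominating G k d)))
γ-exists {n} G k d =
  least (sizeOf? (dominating? G k d)) ∣ ⊤ {n} ∣
        (⊤ , (λ v v∉⊤ → contradiction ∈⊤ v∉⊤) , refl)

-- For disconnected G this is the largest finite distance rather than ∞.
diam : Graph n → ℕ
diam G = proj₁ (diam-exists G)

α : Graph n → (k d : ℕ) → ℕ
α G k d = proj₁ (α-exists G k d)

-- The hypothesis on k is needed for a coloring to exist: no nonempty set is
-- independent for k = 1.
χ : Graph n → (k d : ℕ) → 1 ≤ k ∸ 1 → ℕ
χ G k d 1≤k-1 = proj₁ (χ-exists G k d 1≤k-1)

ω : Graph n → (k d : ℕ) → ℕ
ω G k d = proj₁ (ω-exists G k d)

γ : Graph n → (k d : ℕ) → ℕ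
γ G k d = proj₁ (γ-exists G k d)

{-# OPTIONS --safe #-}
module Submission where

-- Everything except the inequality for ω is monotonicity of the defining
-- predicates.  A k′,d′-clique S with at least k′ vertices is a k,d-clique, because
-- each k-subset of S extends to a k′-subset of S.  If S has fewer than k′
-- vertices, the vertices of a shortest path of length d′ form a k,d-clique of
-- size d′ + 1 ≥ k′; such a path exists because d′ ≤ diam G.

open import Defs
open import Data.Bool.Base using (true; false)
open import Data.Fin.Base using (Fin)
open import Data.Fin.Subset using (Subset; ⁅_⁆; _∈_; _∉_; _⊆_; _-_; ∣_∣)
open import Data.Fin.Subset.Properties
  using ( _∈?_; ∉⊥; x∈⁅x⁆; x∈⁅y⁆⇒x≡y; x∈p∪q⁻; p⊆p∪q; q⊆p∪q
        ; p⊆q⇒∣p∣≤∣q∣; x∈p∧x≢y⇒x∈p-y; x∈p⇒∣p-x∣<∣p∣; s⊆s; out⊆; drop-∷-⊆; ⊆-refl; ⊆-trans)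
open import Data.Nat.Base using (ℕ; suc; NonZero; _≤_; _≥_; _∸_; z≤n; s≤s; s≤s⁻¹)
open import Data.Nat.Properties
  using ( _≤?_; ≤-refl; ≤-trans; <⇒≤; ≰⇒>; <-≤-trans; <⇒≱
        ; m≤n⇒m≤1+n; m≤n⇒m<n∨m≡n; ∸-monoˡ-≤; ≤∧≢⇒<)
open import Data.Product.Base using (∃; ∃-syntax; _×_; _,_; proj₂)
open import Data.Sum.Base using (inj₁; inj₂; [_,_]′)
open import Data.Vec.Base using (Vec; []; _∷_; here; last)
open import Data.Vec.Relation.Unary.All using (All; []; _∷_)
open import Data.Vec.Relation.Unary.AllPairs using ([]; _∷_)
open import Data.Vec.Relation.Unary.Linked using ([-]; _∷_)
open import Data.Vec.Relation.Unary.Unique.Propositional using (Unique)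
open import Function.Base using (_∘_)
open import Level using (0ℓ)
open import Relation.Binary.PropositionalEquality using (_≡_; _≢_; refl; sym; cong)
open import Relation.Nullary using (yes; no; contradiction)
open import Relation.Unary using (Pred; Decidable)

private
  variable
    n l k d k′ d′ : ℕ

-- If `P` failed at the positive bound `suc s`, then `s` would already be an upper bound. Positivity
-- excludes the empty predicate, whose supremum is 0.
supremum-attained : {P : Pred ℕ 0ℓ} → Decidable P → ∀ {s} → IsSupremum P s → 1 ≤ s → P s
supremum-attained P? {suc s} (ub , low) _ with P? (suc s)
... | yes p  = p
... | no  ¬p = contradiction (low s λ m pm → s≤s⁻¹ (≤∧≢⇒< (ub m pm) λ { refl → ¬p pm }))
                             (<⇒≱ ≤-refl)

-- Domination rather than inclusion is assumed because, for `ω`, a small clique is replaced by a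
-- different set that may be larger.
supremum-≤ : {P Q : Pred ℕ 0ℓ} → (∀ {m} → P m → ∃[ m′ ] m ≤ m′ × Q m′) →
             ((s , _) : ∃ (IsSupremum P)) ((t , _) : ∃ (IsSupremum Q)) → s ≤ t
supremum-≤ dominated (_ , _ , low) (_ , ub , _) = low _ λ m pm →
  let m′ , m≤m′ , qm′ = dominated pm in ≤-trans m≤m′ (ub m′ qm′)

least-antimono : {P Q : Pred ℕ 0ℓ} → (∀ {m} → P m → Q m) →
                 ((s , _) : ∃ (IsLeast P)) ((t , _) : ∃ (IsLeast Q)) → t ≤ s
least-antimono P⊆Q (_ , ps , _) (_ , _ , low) = low _ (P⊆Q ps)

-- Greedy choice: an element of `S` outside `T` is skipped as long as the rest of `S` can still
-- supply `m` elements; once it cannot, all of `S` is taken.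
subset-between : (T S : Subset n) → T ⊆ S → ∀ {m} → ∣ T ∣ ≤ m → m ≤ ∣ S ∣ →
                 ∃[ U ] T ⊆ U × U ⊆ S × ∣ U ∣ ≡ m
subset-between [] [] _ _ z≤n = [] , ⊆-refl , ⊆-refl , refl
subset-between (true ∷ T) (true ∷ S) T⊆S (s≤s T≤m) (s≤s m≤S)
  with U , T⊆U , U⊆S , eq ← subset-between T S (drop-∷-⊆ T⊆S) T≤m m≤S
  = true ∷ U , s⊆s T⊆U , s⊆s U⊆S , cong suc eq
subset-between (true ∷ T) (false ∷ S) T⊆S _ _ with () ← T⊆S here
subset-between (false ∷ T) (false ∷ S) T⊆S T≤m m≤S
  with U , T⊆U , U⊆S , eq ← subset-between T S (drop-∷-⊆ T⊆S) T≤m m≤S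
  = false ∷ U , s⊆s T⊆U , s⊆s U⊆S , eq
subset-between (false ∷ T) (true ∷ S) T⊆S T≤m m≤1+S with m≤n⇒m<n∨m≡n m≤1+S
... | inj₂ m≡1+S = true ∷ S , T⊆S , ⊆-refl , sym m≡1+S
... | inj₁ (s≤s m≤S)
  with U , T⊆U , U⊆S , eq ← subset-between T S (drop-∷-⊆ T⊆S) T≤m m≤S
  = false ∷ U , s⊆s T⊆U , out⊆ U⊆S , eq

∈V-∷ˡ : ∀ {x : Fin n} (p : Vec (Fin n) l) → x ∈ V (x ∷ p)
∈V-∷ˡ {x = x} p = p⊆p∪q (V p) (x∈⁅x⁆ x)

∈V-∷ʳ : ∀ {x y : Fin n} (p : Vec (Fin n) l) → x ∈ V p → x ∈ V (y ∷ p)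
∈V-∷ʳ {y = y} p = q⊆p∪q ⁅ y ⁆ (V p)

∉V⇒fresh : ∀ {x : Fin n} (p : Vec (Fin n) l) → x ∉ V p → All (x ≢_) p
∉V⇒fresh []      _  = []
∉V⇒fresh (y ∷ p) x∉ = (λ { refl → x∉ (∈V-∷ˡ p) }) ∷ ∉V⇒fresh p (x∉ ∘ ∈V-∷ʳ p)

fresh⇒∉V : ∀ {x : Fin n} {p : Vec (Fin n) l} → All (x ≢_) p → x ∉ V p
fresh⇒∉V [] = ∉⊥
fresh⇒∉V (_∷_ {x = y} {xs = p} x≢y fresh) =
  [ x≢y ∘ x∈⁅y⁆⇒x≡y y , fresh⇒∉V fresh ]′ ∘ x∈p∪q⁻ ⁅ y ⁆ (V p)

-- `V p` is a union, so repeated entries would collapse. A fresh head `x` leaves `V p` inside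
-- `V (x ∷ p) - x`, which is strictly smaller than `V (x ∷ p)`.
unique⇒length≤∣V∣ : {p : Vec (Fin n) l} → Unique p → l ≤ ∣ V p ∣
unique⇒length≤∣V∣ [] = z≤n
unique⇒length≤∣V∣ (_∷_ {x = x} {xs = p} fresh uniq) =
  ≤-trans (s≤s (≤-trans (unique⇒length≤∣V∣ uniq) (p⊆q⇒∣p∣≤∣q∣ Vp⊆)))
          (x∈p⇒∣p-x∣<∣p∣ (∈V-∷ˡ {x = x} p))
  where
  Vp⊆ : V p ⊆ V (x ∷ p) - x
  Vp⊆ y∈ = x∈p∧x≢y⇒x∈p-y (∈V-∷ʳ p y∈) λ { refl → fresh⇒∉V fresh y∈ }

module _ (G : Graph n) where

  open Graph G

  suffixFrom : ∀ {x} (p : Vec (Fin n) (suc l)) → IsPath G p → x ∈ V p →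
               ∃[ m ] m ≤ l × PathBetween G x (last p) m
  suffixFrom (y ∷ p) path x∈ with x∈p∪q⁻ ⁅ y ⁆ (V p) x∈
  ... | inj₁ x∈y with refl ← x∈⁅y⁆⇒x≡y y x∈y = _ , ≤-refl , y ∷ p , path , refl , refl
  suffixFrom (y ∷ [])    path                      x∈ | inj₂ x∈⊥ = contradiction x∈⊥ ∉⊥
  suffixFrom (y ∷ z ∷ p) (_ ∷ linked , _ ∷ uniq) x∈ | inj₂ x∈p
    with m , m≤l , path ← suffixFrom (z ∷ p) (linked , uniq) x∈p
    = m , m≤n⇒m≤1+n m≤l , path

  -- If x already lies on the path, the part of the path before x is cut off.
  prepend : ∀ {x u v} → Adj x u → PathBetween G u v l →
            ∃[ m ] m ≤ suc l × PathBetween G x v m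
  prepend {x = x} x~u (p , path@(linked , uniq) , refl , refl) with x ∈? V p
  ... | no x∉p = _ , ≤-refl , x ∷ p , (x~u ∷ linked , ∉V⇒fresh p x∉p ∷ uniq) , refl , refl
  ... | yes x∈p with m , m≤l , q ← suffixFrom p path x∈p = m , m≤n⇒m≤1+n m≤l , q

  -- Prepending `x` to a competitor of length `m` gives a path of length `j ≤ suc m` between the
  -- ends of `x ∷ p`. Minimality there gives `suc l ≤ j`, hence `l ≤ m`.
  tail-shortest : ∀ {x} (p : Vec (Fin n) (suc l)) → IsShortestPath G (x ∷ p) → IsShortestPath G p
  tail-shortest p ((x~ ∷ linked , _ ∷ uniq) , _ , minimal) =
    (linked , uniq) , (p , (linked , uniq) , refl , refl) , λ m q →
      let j , j≤1+m , r = prepend x~ q in s≤s⁻¹ (≤-trans (minimal j r) j≤1+m)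

  shortestPath-≤ : ∀ {m} (p : Vec (Fin n) (suc l)) → IsShortestPath G p → m ≤ l →
                   ∃[ q ] IsShortestPath {n} {m} G q
  shortestPath-≤ p sp m≤l with m≤n⇒m<n∨m≡n m≤l
  shortestPath-≤ p       sp _ | inj₂ refl        = p , sp
  shortestPath-≤ (x ∷ p) sp _ | inj₁ (s≤s m≤l) = shortestPath-≤ p (tail-shortest p sp) m≤l

  -- The diameter is positive here, hence attained by some pair of vertices; a shortest path between
  -- them is trimmed from the front down to length `d`.
  shortestPath-≤diam : 1 ≤ d → d ≤ diam G → ∃[ p ] IsShortestPath {n} {d} G p
  shortestPath-≤diam 1≤d d≤diam
    with u , v , dist@((p , path , refl , refl) , _) ← supremum-attained (isDistanceIn? G)
           (proj₂ (diam-exists G)) (≤-trans 1≤d d≤diam)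
    = shortestPath-≤ p (path , dist) d≤diam

  Independent-mono : k ≤ k′ → d′ ≤ d → ∀ {S} → Independent G k d S → Independent G k′ d′ S
  Independent-mono k≤k′ d′≤d ind l p sp l≤d′ = <-≤-trans (ind l p sp (≤-trans l≤d′ d′≤d)) k≤k′

  ColorableWith-mono : k ≤ k′ → d′ ≤ d → ∀ {c} → ColorableWith G k d c → ColorableWith G k′ d′ c
  ColorableWith-mono k≤k′ d′≤d (1≤c , f , col) =
    1≤c , f , λ i → Independent-mono k≤k′ d′≤d (col i)

  Dominating-antimono : k ≤ k′ → d′ ≤ d → ∀ {D} → Dominating G k′ d′ D → Dominating G k d D
  Dominating-antimono k≤k′ d′≤d dom v v∉D
    with l , p , sp , l≤d′ , v∈p , k′-1≤ ← dom v v∉D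
    = l , p , sp , ≤-trans l≤d′ d′≤d , v∈p , ≤-trans (∸-monoˡ-≤ 1 k≤k′) k′-1≤

  Clique-antimono : k ≤ k′ → d′ ≤ d → ∀ {S} → k′ ≤ ∣ S ∣ → Clique G k′ d′ S → Clique G k d S
  Clique-antimono k≤k′ d′≤d {S} k′≤∣S∣ clique T T⊆S refl
    with U , T⊆U , U⊆S , ∣U∣≡k′ ← subset-between T S T⊆S k≤k′ k′≤∣S∣
    with l , p , sp , l≤d′ , U⊆p ← clique U U⊆S ∣U∣≡k′
    = l , p , sp , ≤-trans l≤d′ d′≤d , ⊆-trans T⊆U U⊆p

  -- The single path `p` serves as witness for every `T`, so this holds for all `k`.
  shortestPath⇒Clique : (p : Vec (Fin n) (suc l)) → IsShortestPath G p → l ≤ d → Clique G k d (V p)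
  shortestPath⇒Clique p sp l≤d T T⊆p _ = _ , p , sp , l≤d , T⊆p

  α-mono : k ≤ k′ → d′ ≤ d → α G k d ≤ α G k′ d′
  α-mono {k} {k′} {d′} {d} k≤k′ d′≤d =
    supremum-≤ (λ (S , ind , eq) → _ , ≤-refl , S , Independent-mono k≤k′ d′≤d ind , eq)
               (α-exists G k d) (α-exists G k′ d′)

  χ-antimono : ∀ (1≤k-1 : 1 ≤ k ∸ 1) (1≤k′-1 : 1 ≤ k′ ∸ 1) → k ≤ k′ → d′ ≤ d →
               χ G k′ d′ 1≤k′-1 ≤ χ G k d 1≤k-1
  χ-antimono {k} {k′} {d′} {d} 1≤k-1 1≤k′-1 k≤k′ d′≤d =
    least-antimono (ColorableWith-mono k≤k′ d′≤d)
                   (χ-exists G k d 1≤k-1) (χ-exists G k′ d′ 1≤k′-1)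

  Clique⇒larger-Clique : 1 ≤ d′ → d′ ≤ diam G → k′ ≤ suc d′ → k ≤ k′ → d′ ≤ d →
                         ∀ {S} → Clique G k′ d′ S → ∃[ S′ ] Clique G k d S′ × ∣ S ∣ ≤ ∣ S′ ∣
  Clique⇒larger-Clique {k′ = k′} 1≤d′ d′≤diam k′≤1+d′ k≤k′ d′≤d {S} clique
    with k′ ≤? ∣ S ∣
  ... | yes k′≤∣S∣ = S , Clique-antimono k≤k′ d′≤d k′≤∣S∣ clique , ≤-refl
  -- Here `S` is a `k′`,`d′`-clique only vacuously and may fail to be a `k`,`d`-clique. A path of
  -- length `d′` has `suc d′` vertices, so `∣ S ∣ < k′ ≤ suc d′ ≤ ∣ V p ∣`.
  ... | no  k′≰∣S∣ =
    let p , sp@((_ , uniq) , _) = shortestPath-≤diam 1≤d′ d′≤diam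
    in V p , shortestPath⇒Clique p sp d′≤d ,
       ≤-trans (<⇒≤ (≰⇒> k′≰∣S∣)) (≤-trans k′≤1+d′ (unique⇒length≤∣V∣ uniq))

  ω-antimono : 1 ≤ d′ → d′ ≤ diam G → k′ ≤ suc d′ → k ≤ k′ → d′ ≤ d → ω G k′ d′ ≤ ω G k d
  ω-antimono {d′} {k′} {k} {d} 1≤d′ d′≤diam k′≤1+d′ k≤k′ d′≤d =
    supremum-≤ enlarge (ω-exists G k′ d′) (ω-exists G k d)
    where
    enlarge : ∀ {m} → SizeOf (Clique G k′ d′) m → ∃[ m′ ] m ≤ m′ × SizeOf (Clique G k d) m′
    enlarge (S , clique , refl) =
      let S′ , clique′ , S≤S′ = Clique⇒larger-Clique 1≤d′ d′≤diam k′≤1+d′ k≤k′ d′≤d clique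
      in ∣ S′ ∣ , S≤S′ , S′ , clique′ , refl

  γ-mono : k ≤ k′ → d′ ≤ d → γ G k d ≤ γ G k′ d′
  γ-mono {k} {k′} {d′} {d} k≤k′ d′≤d =
    least-antimono (λ (D , dom , size) → D , Dominating-antimono k≤k′ d′≤d dom , size)
                   (γ-exists G k′ d′) (γ-exists G k d)

proposition2p8 : ∀ {n : ℕ} (G : Graph n) → Connected G →
    ∀ (k d k′ d′ : ℕ) .{{_ : NonZero k}} .{{_ : NonZero d}} .{{_ : NonZero k′}} .{{_ : NonZero d′}} →
    (1≤k-1 : 1 ≤ k ∸ 1) → k ∸ 1 ≤ d → d ≤ diam G →
    (1≤k′-1 : 1 ≤ k′ ∸ 1) → k′ ∸ 1 ≤ d′ → d′ ≤ diam G →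
    d′ ≤ d → k′ ≥ k →
    (α G k d ≤ α G k′ d′) ×
    (χ G k d 1≤k-1 ≥ χ G k′ d′ 1≤k′-1) ×
    (ω G k d ≥ ω G k′ d′) ×
    (γ G k d ≤ γ G k′ d′)
-- Without the explicit arguments, unification unfolds the exhaustive searches behind α, χ, ω and γ.
proposition2p8 G _ k d (suc k′) d′ 1≤k-1 _ _ 1≤k′ k′≤d′ d′≤diam d′≤d k≤k′ =
  α-mono G {k} {suc k′} {d′} {d} k≤k′ d′≤d ,
  χ-antimono G {k} {suc k′} {d′} {d} 1≤k-1 1≤k′ k≤k′ d′≤d ,
  -- With the larger parameter written `suc k′`, the hypotheses read `1 ≤ k′ ≤ d′`, which yields
  -- both `1 ≤ d′` and `suc k′ ≤ suc d′`.
  ω-antimono G {d′} {suc k′} {k} {d} (≤-trans 1≤k′ k′≤d′) d′≤diam (s≤s k′≤d′) k≤k′ d′≤d ,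
  γ-mono G {k} {suc k′} {d′} {d} k≤k′ d′≤d
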